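{- Let $k,n$ be integers with $n\geq 2$ and $k\geq 3$, and let $c$ be an exact $k$-coloring of $\mathcal{B}_n$. Then $\mathcal{B}_n$ contains no rainbow induced copy of $\mathcal{C}_3$ if and only if $c(\emptyset)=c([n])$ and, for any two sets $X,Y$ with $\emptyset\subsetneq X,Y\subsetneq[n]$ such that $c(X),c(Y),c(\emptyset)$ are pairwise distinct, $X$ and $Y$ are incomparable.
   Context: $\mathcal{B}_n$ denotes the Boolean lattice of all subsets of $[n]$ ordered by inclusion. An exact $k$-coloring of $\mathcal{B}_n$ is a map from $\mathcal{B}_n$ to $[k]$ that is surjective. A rainbow induced copy of $\mathcal{C}_3$ is a chain $X\subsetneq Y\subsetneq Z$ in $\mathcal{B}_n$ with $c(X),c(Y),c(Z)$ pairwise distinct. -}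

module Defs where

open import Data.Fin.Base using (Fin)
open import Data.Fin.Subset using (Subset; _⊂_; _⊈_)
open import Data.Nat.Base using (ℕ)
open import Data.Product.Base using (_×_; ∃-syntax)
open import Function.Definitions using (Surjective)
open import Relation.Binary.PropositionalEquality.Core using (_≡_; _≢_)

-- The Boolean lattice 𝓑ₙ is Subset n ordered by _⊆_; the ground set [n] and
-- the colour set [k] are Fin n and Fin k.
Coloring : ℕ → ℕ → Set
Coloring n k = Subset n → Fin k

Exact : ∀ {n k} → Coloring n k → Set
Exact c = Surjective _≡_ _≡_ c

PairwiseDistinct : {A : Set} → A → A → A → Set
PairwiseDistinct x y z = x ≢ y × x ≢ z × y ≢ z

Incomparable : ∀ {n} → Subset n → Subset n → Set
Incomparable X Y = X ⊈ Y × Y ⊈ X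

HasRainbowC₃ : ∀ {n k} → Coloring n k → Set
HasRainbowC₃ c =
  ∃[ X ] ∃[ Y ] ∃[ Z ] X ⊂ Y × Y ⊂ Z × PairwiseDistinct (c X) (c Y) (c Z)

{-# OPTIONS --safe #-}
module Submission where

-- If c ⊥ ≢ c ⊤, a set of a third colour lies strictly between ⊥ and ⊤ and gives
-- a rainbow chain; and a comparable pair avoiding the colour of ⊥ extends by ⊥ to
-- a rainbow chain.  Conversely, two members of a rainbow chain avoid the colour
-- c ⊥ ≡ c ⊤, so they form a comparable pair of proper nonempty sets.

open import Defs
open import Data.Fin.Base using (Fin; zero; punchIn; punchOut)
open import Data.Fin.Properties using (_≟_; punchInᵢ≢i; punchIn-injective; punchIn-punchOut)
open import Data.Fin.Subset using (Subset; inside; outside; ⊥; ⊤; _⊂_; _⊆_)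
open import Data.Fin.Subset.Properties
  using (⊥⊆; ⊆⊤; ⊂-trans; drop-∷-⊆; out⊂; out⊂in; in⊂in)
open import Data.Nat.Base using (ℕ; _≥_; s≤s)
open import Data.Product.Base using (_×_; _,_; proj₁; ∃-syntax)
open import Data.Vec.Base using ([]; _∷_; here)
open import Function.Base using (_∘_)
open import Function.Bundles using (_⇔_; mk⇔)
open import Relation.Binary.PropositionalEquality.Core
  using (_≡_; _≢_; refl; sym; trans; cong; ≢-sym)
open import Relation.Nullary.Decidable using (yes; no; decidable-stable)
open import Relation.Nullary.Negation using (contradiction)
open import Relation.Nullary.Negation.Core using (¬_)

-- `_⊂_` carries an explicit element of `q` outside `p`, so it must be extracted from `p ≢ q`: the
-- recursion stops at the first coordinate where the two differ.
⊆∧≢⇒⊂ : ∀ {n} {p q : Subset n} → p ⊆ q → p ≢ q → p ⊂ q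
⊆∧≢⇒⊂ {p = []}          {[]}          p⊆q p≢q = contradiction refl p≢q
⊆∧≢⇒⊂ {p = outside ∷ p} {outside ∷ q} p⊆q p≢q =
  out⊂ (⊆∧≢⇒⊂ (drop-∷-⊆ p⊆q) (p≢q ∘ cong (outside ∷_)))
⊆∧≢⇒⊂ {p = outside ∷ p} {inside ∷ q}  p⊆q p≢q = out⊂in (drop-∷-⊆ p⊆q)
⊆∧≢⇒⊂ {p = inside ∷ p}  {outside ∷ q} p⊆q p≢q = contradiction (p⊆q here) λ ()
⊆∧≢⇒⊂ {p = inside ∷ p}  {inside ∷ q}  p⊆q p≢q =
  in⊂in (⊆∧≢⇒⊂ (drop-∷-⊆ p⊆q) (p≢q ∘ cong (inside ∷_)))

third-element : ∀ {k} → k ≥ 3 → {i j : Fin k} → i ≢ j → ∃[ l ] l ≢ i × l ≢ j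
third-element (s≤s (s≤s (s≤s _))) {i} {j} i≢j =
  -- Deleting `i`, then the image of `j`, leaves k - 2 ≥ 1 colours; `zero` is the first of these,
  -- and the two `punchIn`s carry it back.
  punchIn i l , punchInᵢ≢i i l ,
  λ eq → punchInᵢ≢i (punchOut i≢j) zero
    (punchIn-injective i l (punchOut i≢j) (trans eq (sym (punchIn-punchOut i≢j))))
  where l = punchIn (punchOut i≢j) zero

module _ {n k : ℕ} (c : Coloring n k) where

  ⊆∧colour≢⇒⊂ : ∀ {X Y} → X ⊆ Y → c X ≢ c Y → X ⊂ Y
  ⊆∧colour≢⇒⊂ X⊆Y cX≢cY = ⊆∧≢⇒⊂ X⊆Y (cX≢cY ∘ cong c)

  IncomparableOffBottom : Set
  IncomparableOffBottom =
    (X Y : Subset n) → ⊥ ⊂ X → X ⊂ ⊤ → ⊥ ⊂ Y → Y ⊂ ⊤ →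
    PairwiseDistinct (c X) (c Y) (c ⊥) → Incomparable X Y

  noRainbow⇒c⊥≡c⊤ : k ≥ 3 → Exact c → ¬ HasRainbowC₃ c → c ⊥ ≡ c ⊤
  noRainbow⇒c⊥≡c⊤ k≥3 exact noRainbow = decidable-stable (c ⊥ ≟ c ⊤) rainbow
    where
    rainbow : ¬ (c ⊥ ≢ c ⊤)
    rainbow c⊥≢c⊤ with third-element k≥3 c⊥≢c⊤
    ... | l , l≢c⊥ , l≢c⊤ with exact l
    -- `hit` covers every set equal to `X`; at `refl` it yields `c X ≡ l`.
    ... | X , hit with hit refl
    ... | refl = noRainbow
      (⊥ , X , ⊤ , ⊆∧colour≢⇒⊂ ⊥⊆ (≢-sym l≢c⊥) , ⊆∧colour≢⇒⊂ ⊆⊤ l≢c⊤ ,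
       ≢-sym l≢c⊥ , c⊥≢c⊤ , l≢c⊤)

  noRainbow⇒incomparable : ¬ HasRainbowC₃ c → IncomparableOffBottom
  noRainbow⇒incomparable noRainbow X Y ⊥⊂X _ ⊥⊂Y _ (cX≢cY , cX≢c⊥ , cY≢c⊥) =
    (λ X⊆Y → noRainbow
      (⊥ , X , Y , ⊥⊂X , ⊆∧colour≢⇒⊂ X⊆Y cX≢cY ,
       ≢-sym cX≢c⊥ , ≢-sym cY≢c⊥ , cX≢cY)) ,
    (λ Y⊆X → noRainbow
      (⊥ , Y , X , ⊥⊂Y , ⊆∧colour≢⇒⊂ Y⊆X (≢-sym cX≢cY) ,
       ≢-sym cY≢c⊥ , ≢-sym cX≢c⊥ , ≢-sym cX≢cY))

  module _ (c⊥≡c⊤ : c ⊥ ≡ c ⊤) (incomparable : IncomparableOffBottom) where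

    -- A set coloured unlike `⊥` is also coloured unlike `⊤`, as these two agree, hence is strictly
    -- between them; so `incomparable` applies to the pair and contradicts `X ⊆ Y`.
    ⊂⇒¬bothOffBottom : ∀ {X Y} → X ⊂ Y → c X ≢ c Y → c X ≢ c ⊥ → ¬ (c Y ≢ c ⊥)
    ⊂⇒¬bothOffBottom {X} {Y} X⊂Y cX≢cY cX≢c⊥ cY≢c⊥ =
      proj₁ (incomparable X Y (⊥⊂ cX≢c⊥) (⊂⊤ cX≢c⊥) (⊥⊂ cY≢c⊥) (⊂⊤ cY≢c⊥)
        (cX≢cY , cX≢c⊥ , cY≢c⊥)) (proj₁ X⊂Y)
      where
      ⊥⊂ : ∀ {A} → c A ≢ c ⊥ → ⊥ ⊂ A
      ⊥⊂ cA≢c⊥ = ⊆∧colour≢⇒⊂ ⊥⊆ (≢-sym cA≢c⊥)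

      ⊂⊤ : ∀ {A} → c A ≢ c ⊥ → A ⊂ ⊤
      ⊂⊤ cA≢c⊥ = ⊆∧colour≢⇒⊂ ⊆⊤ (λ eq → cA≢c⊥ (trans eq (sym c⊥≡c⊤)))

    incomparable⇒noRainbow : ¬ HasRainbowC₃ c
    incomparable⇒noRainbow (X , Y , Z , X⊂Y , Y⊂Z , cX≢cY , cX≢cZ , cY≢cZ)
      -- At most one of three distinct colours is `c ⊥`. The cases select two sets avoiding it: `X`
      -- and `Y`, or `X` and `Z`, or `Y` and `Z`.
      with c X ≟ c ⊥ | c Y ≟ c ⊥
    ... | no cX≢c⊥  | no cY≢c⊥  = ⊂⇒¬bothOffBottom X⊂Y cX≢cY cX≢c⊥ cY≢c⊥
    ... | no cX≢c⊥  | yes cY≡c⊥ =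
      ⊂⇒¬bothOffBottom (⊂-trans X⊂Y Y⊂Z) cX≢cZ cX≢c⊥
        (λ cZ≡c⊥ → cY≢cZ (trans cY≡c⊥ (sym cZ≡c⊥)))
    ... | yes cX≡c⊥ | _         =
      ⊂⇒¬bothOffBottom Y⊂Z cY≢cZ
        (λ cY≡c⊥ → cX≢cY (trans cX≡c⊥ (sym cY≡c⊥)))
        (λ cZ≡c⊥ → cX≢cZ (trans cX≡c⊥ (sym cZ≡c⊥)))

theorem2p1 : (k n : ℕ) → n ≥ 2 → k ≥ 3 → (c : Coloring n k) → Exact c →
    (¬ HasRainbowC₃ c) ⇔
    (c ⊥ ≡ c ⊤ ×
    ((X Y : Subset n) → ⊥ ⊂ X → X ⊂ ⊤ → ⊥ ⊂ Y → Y ⊂ ⊤ →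
    PairwiseDistinct (c X) (c Y) (c ⊥) → Incomparable X Y))
theorem2p1 k n _ k≥3 c exact = mk⇔
  (λ noRainbow →
    noRainbow⇒c⊥≡c⊤ c k≥3 exact noRainbow , noRainbow⇒incomparable c noRainbow)
  (λ (c⊥≡c⊤ , incomparable) → incomparable⇒noRainbow c c⊥≡c⊤ incomparable)
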